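{- Let $\alpha_i\ge 0$, $\beta_i>0$ ($i\in\{1,2,4,5\}$) and $Q>0$ be real numbers. In the network $N$ with these parameters and total flow $Q$, the travel time at equilibrium is as follows: (a) $T_{Eq}=\alpha_{45}+Q\beta_{45}$ if $0<Q\le -\alpha/\beta_{45}$; (b) $T_{Eq}=\alpha_{12}+Q\beta_{12}$ if $0<Q\le \alpha/\beta_{12}$; (c) $T_{Eq}=\alpha_{12}+(\alpha+Q\beta_{45})\beta_{12}/\beta$ if $Q>\max\{\alpha/\beta_{12},\,-\alpha/\beta_{45}\}$.
   Context: The network $N$ has nodes $a,b,c,d$ and directed links $(a,b),(b,d),(a,c),(c,d)$ with travel times $\alpha_1+\beta_1f_{ab}$, $\alpha_2+\beta_2f_{bd}$, $\alpha_4+\beta_4f_{ac}$, $\alpha_5+\beta_5f_{cd}$ respectively, where $f_{ij}\ge 0$ is the (real) flow on link $(i,j)$ and $\alpha_i\ge 0$, $\beta_i>0$. All traffic, of total amount $Q>0$ (real), goes from $a$ to $d$ along the paths $P_1=a-b-d$ and $P_2=a-c-d$. A flow assigns a non-negative real amount to each path, with total $Q$; the flow on a link is the flow of the path containing it; the travel time on a path is the sum of the travel times of its links. A path has vanishing flow if its path flow is $0$. The network is at equilibrium if all paths with non-vanishing flow have the same travel time, and every path with vanishing flow has travel time at least this common value. The equilibrium exists and is unique; its common travel time is denoted $T_{Eq}$. Notation: $\alpha_{ij}=\alpha_i+\alpha_j$, $\beta_{ij}=\beta_i+\beta_j$, $\alpha=\alpha_{45}-\alpha_{12}$, $\beta=\beta_1+\beta_2+\beta_4+\beta_5$.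 -}

module Defs where

open import Data.Nat.Base as ℕ using (ℕ)
import Data.Nat.Properties as ℕ
open import Data.Product using (∃; ∃-syntax; _×_; _,_)
open import Data.Rational.Base as ℚ using (ℚ; 0ℚ; 1ℚ; ½; ∣_∣)
import Data.Rational.Properties as ℚ
open import Data.Rational.Solver using (module +-*-Solver)
open import Data.Sum.Base using (inj₁; inj₂)
open import Relation.Binary.Construct.Closure.ReflexiveTransitive
  using (Star; ε; _◅_)
open import Relation.Binary.PropositionalEquality
  using (_≡_; refl; sym; trans; cong; cong₂; subst; subst₂)
open import Relation.Nullary using (¬_; yes; no; contradiction)

open +-*-Solver using (solve; _:+_; _:-_; _:*_; :-_; _:=_; con)

module Estimates where

  0<½e : ∀ {e} → 0ℚ ℚ.< e → 0ℚ ℚ.< ½ ℚ.* e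
  0<½e {e} 0<e = subst (ℚ._< ½ ℚ.* e) (ℚ.*-zeroʳ ½) (ℚ.*-monoʳ-<-pos ½ 0<e)

  halves : ∀ e → ½ ℚ.* e ℚ.+ ½ ℚ.* e ≡ e
  halves = solve 1 (λ e → con ½ :* e :+ con ½ :* e := e) refl

  ∣p-q∣≡∣q-p∣ : ∀ p q → ∣ p ℚ.- q ∣ ≡ ∣ q ℚ.- p ∣
  ∣p-q∣≡∣q-p∣ p q = trans (sym (ℚ.∣-p∣≡∣p∣ (p ℚ.- q)))
    (cong ∣_∣ (solve 2 (λ p q → :- (p :- q) := q :- p) refl p q))

  p≤∣p∣ : ∀ p → p ℚ.≤ ∣ p ∣
  p≤∣p∣ p with ℚ.≤-total 0ℚ p
  ... | inj₁ 0≤p = ℚ.≤-reflexive (sym (ℚ.0≤p⇒∣p∣≡p 0≤p))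
  ... | inj₂ p≤0 = ℚ.≤-trans p≤0 (ℚ.0≤∣p∣ p)

  ∣p∣<e : ∀ {p e} → p ℚ.< e → ℚ.- p ℚ.< e → ∣ p ∣ ℚ.< e
  ∣p∣<e {p} {e} p<e -p<e with ℚ.∣p∣≡p∨∣p∣≡-p p
  ... | inj₁ eq = subst (ℚ._< e) (sym eq) p<e
  ... | inj₂ eq = subst (ℚ._< e) (sym eq) -p<e

  +-close : ∀ {e} p p′ q q′ →
            ∣ p ℚ.- p′ ∣ ℚ.< ½ ℚ.* e → ∣ q ℚ.- q′ ∣ ℚ.< ½ ℚ.* e →
            ∣ (p ℚ.+ q) ℚ.- (p′ ℚ.+ q′) ∣ ℚ.< e
  +-close {e} p p′ q q′ hp hq = begin-strict
    ∣ (p ℚ.+ q) ℚ.- (p′ ℚ.+ q′) ∣      ≡⟨ cong ∣_∣ (solve 4 (λ p p′ q q′ →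
                                           (p :+ q) :- (p′ :+ q′) := (p :- p′) :+ (q :- q′))
                                           refl p p′ q q′) ⟩
    ∣ (p ℚ.- p′) ℚ.+ (q ℚ.- q′) ∣      ≤⟨ ℚ.∣p+q∣≤∣p∣+∣q∣ (p ℚ.- p′) (q ℚ.- q′) ⟩
    ∣ p ℚ.- p′ ∣ ℚ.+ ∣ q ℚ.- q′ ∣      <⟨ ℚ.+-mono-< hp hq ⟩
    ½ ℚ.* e ℚ.+ ½ ℚ.* e                ≡⟨ halves e ⟩
    e                                  ∎
    where open ℚ.≤-Reasoning

  -‿close : ∀ {e} p p′ → ∣ p ℚ.- p′ ∣ ℚ.< e → ∣ (ℚ.- p) ℚ.- (ℚ.- p′) ∣ ℚ.< e
  -‿close {e} p p′ = subst (ℚ._< e) (trans (∣p-q∣≡∣q-p∣ p p′)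
    (cong ∣_∣ (solve 2 (λ p p′ → p′ :- p := (:- p) :- (:- p′)) refl p p′)))

  ⊔-below : ∀ {e} p p′ q q′ → ∣ p ℚ.- p′ ∣ ℚ.< e → ∣ q ℚ.- q′ ∣ ℚ.< e →
            (p ℚ.⊔ q) ℚ.- (p′ ℚ.⊔ q′) ℚ.< e
  ⊔-below {e} p p′ q q′ hp hq with ℚ.⊔-sel p q
  ... | inj₁ eq = begin-strict
    (p ℚ.⊔ q) ℚ.- (p′ ℚ.⊔ q′)  ≡⟨ cong (ℚ._- (p′ ℚ.⊔ q′)) eq ⟩
    p ℚ.- (p′ ℚ.⊔ q′)          ≤⟨ ℚ.+-monoʳ-≤ p (ℚ.neg-antimono-≤ (ℚ.p≤p⊔q p′ q′)) ⟩
    p ℚ.- p′                   ≤⟨ p≤∣p∣ (p ℚ.- p′) ⟩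
    ∣ p ℚ.- p′ ∣               <⟨ hp ⟩
    e                          ∎
    where open ℚ.≤-Reasoning
  ... | inj₂ eq = begin-strict
    (p ℚ.⊔ q) ℚ.- (p′ ℚ.⊔ q′)  ≡⟨ cong (ℚ._- (p′ ℚ.⊔ q′)) eq ⟩
    q ℚ.- (p′ ℚ.⊔ q′)          ≤⟨ ℚ.+-monoʳ-≤ q (ℚ.neg-antimono-≤ (ℚ.p≤q⊔p p′ q′)) ⟩
    q ℚ.- q′                   ≤⟨ p≤∣p∣ (q ℚ.- q′) ⟩
    ∣ q ℚ.- q′ ∣               <⟨ hq ⟩
    e                          ∎
    where open ℚ.≤-Reasoning

  ⊔-close : ∀ {e} p p′ q q′ → ∣ p ℚ.- p′ ∣ ℚ.< e → ∣ q ℚ.- q′ ∣ ℚ.< e →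
            ∣ (p ℚ.⊔ q) ℚ.- (p′ ℚ.⊔ q′) ∣ ℚ.< e
  ⊔-close {e} p p′ q q′ hp hq = ∣p∣<e (⊔-below p p′ q q′ hp hq)
    (subst (ℚ._< e)
      (solve 2 (λ s t → t :- s := :- (s :- t)) refl (p ℚ.⊔ q) (p′ ℚ.⊔ q′))
      (⊔-below p′ p q′ q (subst (ℚ._< e) (∣p-q∣≡∣q-p∣ p p′) hp)
                         (subst (ℚ._< e) (∣p-q∣≡∣q-p∣ q q′) hq)))

  shrink : ∀ {b e} → 0ℚ ℚ.< b → 0ℚ ℚ.< e → ∃[ d ] 0ℚ ℚ.< d × b ℚ.* d ≡ e
  shrink {b} {e} 0<b 0<e = e ℚ.* b⁻¹ , 0<d , eq
    where
    instance
      b>0 = ℚ.positive 0<b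
      b≢0 = ℚ.pos⇒nonZero b
    b⁻¹ = ℚ.1/ b
    instance b⁻¹>0 = ℚ.1/pos⇒pos b
    0<d : 0ℚ ℚ.< e ℚ.* b⁻¹
    0<d = subst (ℚ._< e ℚ.* b⁻¹) (ℚ.*-zeroˡ b⁻¹) (ℚ.*-monoˡ-<-pos b⁻¹ 0<e)
    eq : b ℚ.* (e ℚ.* b⁻¹) ≡ e
    eq = trans (solve 3 (λ b e c → b :* (e :* c) := e :* (b :* c)) refl b e b⁻¹)
               (trans (cong (e ℚ.*_) (ℚ.*-inverseʳ b)) (ℚ.*-identityʳ e))

  ∣*∣-mono-< : ∀ {b d e} p q → 0ℚ ℚ.< b → b ℚ.* d ≡ e →
               ∣ p ∣ ℚ.≤ b → ∣ q ∣ ℚ.< d → ∣ p ℚ.* q ∣ ℚ.< e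
  ∣*∣-mono-< {b} {d} {e} p q 0<b eq hp hq = begin-strict
    ∣ p ℚ.* q ∣      ≡⟨ ℚ.∣p*q∣≡∣p∣*∣q∣ p q ⟩
    ∣ p ∣ ℚ.* ∣ q ∣  ≤⟨ ℚ.*-monoʳ-≤-nonNeg ∣ q ∣ {{ℚ.∣-∣-nonNeg q}} hp ⟩
    b ℚ.* ∣ q ∣      <⟨ ℚ.*-monoʳ-<-pos b {{ℚ.positive 0<b}} hq ⟩
    b ℚ.* d          ≡⟨ eq ⟩
    e                ∎
    where open ℚ.≤-Reasoning

  *-close : ∀ {b c d d′ e} p p′ q q′ → 0ℚ ℚ.< b → 0ℚ ℚ.< c →
            b ℚ.* d ≡ ½ ℚ.* e → c ℚ.* d′ ≡ ½ ℚ.* e →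
            ∣ p ∣ ℚ.≤ b → ∣ q′ ∣ ℚ.≤ c →
            ∣ p ℚ.- p′ ∣ ℚ.< d′ → ∣ q ℚ.- q′ ∣ ℚ.< d →
            ∣ p ℚ.* q ℚ.- p′ ℚ.* q′ ∣ ℚ.< e
  *-close {e = e} p p′ q q′ 0<b 0<c bd≡ cd′≡ hb hc hp hq = begin-strict
    ∣ p ℚ.* q ℚ.- p′ ℚ.* q′ ∣
      ≡⟨ cong ∣_∣ (solve 4 (λ p p′ q q′ →
           p :* q :- p′ :* q′ := p :* (q :- q′) :+ q′ :* (p :- p′)) refl p p′ q q′) ⟩
    ∣ p ℚ.* (q ℚ.- q′) ℚ.+ q′ ℚ.* (p ℚ.- p′) ∣
      ≤⟨ ℚ.∣p+q∣≤∣p∣+∣q∣ (p ℚ.* (q ℚ.- q′)) (q′ ℚ.* (p ℚ.- p′)) ⟩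
    ∣ p ℚ.* (q ℚ.- q′) ∣ ℚ.+ ∣ q′ ℚ.* (p ℚ.- p′) ∣
      <⟨ ℚ.+-mono-< (∣*∣-mono-< p (q ℚ.- q′) 0<b bd≡ hb hq)
                    (∣*∣-mono-< q′ (p ℚ.- p′) 0<c cd′≡ hc hp) ⟩
    ½ ℚ.* e ℚ.+ ½ ℚ.* e
      ≡⟨ halves e ⟩
    e ∎
    where open ℚ.≤-Reasoning

open Estimates

-- Reals are Cauchy sequences of rationals, considered up to _≈_.

IsCauchy : (ℕ → ℚ) → Set
IsCauchy x = ∀ e → 0ℚ ℚ.< e →
  ∃[ N ] (∀ m n → N ℕ.≤ m → N ℕ.≤ n → ∣ x m ℚ.- x n ∣ ℚ.< e)

record ℝ : Set where
  constructor mkℝ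
  field
    seq    : ℕ → ℚ
    cauchy : IsCauchy seq

open ℝ public

infix 4 _≈_ _<_ _≤_

_≈_ : ℝ → ℝ → Set
x ≈ y = ∀ e → 0ℚ ℚ.< e → ∃[ N ] (∀ n → N ℕ.≤ n → ∣ seq x n ℚ.- seq y n ∣ ℚ.< e)

_<_ : ℝ → ℝ → Set
x < y = ∃[ e ] 0ℚ ℚ.< e × (∃[ N ] (∀ n → N ℕ.≤ n → seq x n ℚ.+ e ℚ.< seq y n))

_≤_ : ℝ → ℝ → Set
x ≤ y = ¬ (y < x)

0ℝ : ℝ
0ℝ = mkℝ (λ _ → 0ℚ) (λ e 0<e → 0 , λ _ _ _ _ → 0<e)

infixl 7 _*_
infixl 6 _+_ _-_ _⊔_
infix  8 -_

private
  ≤₁ : ∀ i j {n} → i ℕ.⊔ j ℕ.≤ n → i ℕ.≤ n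
  ≤₁ i j = ℕ.m⊔n≤o⇒m≤o i j

  ≤₂ : ∀ i j {n} → i ℕ.⊔ j ℕ.≤ n → j ℕ.≤ n
  ≤₂ i j = ℕ.m⊔n≤o⇒n≤o i j

  Bounded : (ℕ → ℚ) → Set
  Bounded x = ∃[ B ] 0ℚ ℚ.< B × (∃[ N ] (∀ n → N ℕ.≤ n → ∣ x n ∣ ℚ.≤ B))

  bounded : ∀ x → IsCauchy x → Bounded x
  bounded x cx with cx 1ℚ (ℚ.positive⁻¹ 1ℚ)
  ... | N , h = 1ℚ ℚ.+ ∣ x N ∣ , 0<B , N , bound
    where
    open ℚ.≤-Reasoning
    0<B : 0ℚ ℚ.< 1ℚ ℚ.+ ∣ x N ∣
    0<B = ℚ.+-mono-<-≤ (ℚ.positive⁻¹ 1ℚ) (ℚ.0≤∣p∣ (x N))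
    bound : ∀ n → N ℕ.≤ n → ∣ x n ∣ ℚ.≤ 1ℚ ℚ.+ ∣ x N ∣
    bound n N≤n = begin
      ∣ x n ∣                          ≡⟨ cong ∣_∣ (solve 2 (λ p q → p := (p :- q) :+ q)
                                            refl (x n) (x N)) ⟩
      ∣ (x n ℚ.- x N) ℚ.+ x N ∣        ≤⟨ ℚ.∣p+q∣≤∣p∣+∣q∣ (x n ℚ.- x N) (x N) ⟩
      ∣ x n ℚ.- x N ∣ ℚ.+ ∣ x N ∣      ≤⟨ ℚ.+-monoˡ-≤ ∣ x N ∣
                                            (ℚ.<⇒≤ (h n N N≤n ℕ.≤-refl)) ⟩
      1ℚ ℚ.+ ∣ x N ∣                   ∎

_+_ : ℝ → ℝ → ℝ
seq (x + y) n = seq x n ℚ.+ seq y n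
cauchy (x + y) e 0<e
  with cauchy x (½ ℚ.* e) (0<½e 0<e) | cauchy y (½ ℚ.* e) (0<½e 0<e)
... | M , hx | N , hy = M ℕ.⊔ N , λ m n hm hn →
  +-close (seq x m) (seq x n) (seq y m) (seq y n)
    (hx m n (≤₁ M N hm) (≤₁ M N hn)) (hy m n (≤₂ M N hm) (≤₂ M N hn))

-_ : ℝ → ℝ
seq (- x) n = ℚ.- seq x n
cauchy (- x) e 0<e with cauchy x e 0<e
... | N , h = N , λ m n hm hn → -‿close (seq x m) (seq x n) (h m n hm hn)

_-_ : ℝ → ℝ → ℝ
x - y = x + (- y)

_⊔_ : ℝ → ℝ → ℝ
seq (x ⊔ y) n = seq x n ℚ.⊔ seq y n
cauchy (x ⊔ y) e 0<e with cauchy x e 0<e | cauchy y e 0<e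
... | M , hx | N , hy = M ℕ.⊔ N , λ m n hm hn →
  ⊔-close (seq x m) (seq x n) (seq y m) (seq y n)
    (hx m n (≤₁ M N hm) (≤₁ M N hn)) (hy m n (≤₂ M N hm) (≤₂ M N hn))

private
  module Product {x y : ℕ → ℚ} (cx : IsCauchy x) (cy : IsCauchy y)
                 (e : ℚ) (0<e : 0ℚ ℚ.< e) where

    Goal : Set
    Goal = ∃[ N ] (∀ m n → N ℕ.≤ m → N ℕ.≤ n →
                   ∣ x m ℚ.* y m ℚ.- x n ℚ.* y n ∣ ℚ.< e)

    step₃ : ∀ {B C b c} → 0ℚ ℚ.< B → 0ℚ ℚ.< C → B ℚ.* b ≡ ½ ℚ.* e → C ℚ.* c ≡ ½ ℚ.* e →
            ∃[ K ] (∀ n → K ℕ.≤ n → ∣ x n ∣ ℚ.≤ B) →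
            ∃[ L ] (∀ n → L ℕ.≤ n → ∣ y n ∣ ℚ.≤ C) →
            ∃[ M ] (∀ m n → M ℕ.≤ m → M ℕ.≤ n → ∣ x m ℚ.- x n ∣ ℚ.< c) →
            ∃[ N ] (∀ m n → N ℕ.≤ m → N ℕ.≤ n → ∣ y m ℚ.- y n ∣ ℚ.< b) →
            Goal
    step₃ 0<B 0<C Bb≡ Cc≡ (K , hB) (L , hC) (M , hx) (N , hy) =
      (K ℕ.⊔ L) ℕ.⊔ (M ℕ.⊔ N) , λ m n hm hn →
        *-close (x m) (x n) (y m) (y n) 0<B 0<C Bb≡ Cc≡
          (hB m (≤₁ K L (≤₁ _ _ hm))) (hC n (≤₂ K L (≤₁ _ _ hn)))
          (hx m n (≤₁ M N (≤₂ (K ℕ.⊔ L) _ hm)) (≤₁ M N (≤₂ (K ℕ.⊔ L) _ hn)))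
          (hy m n (≤₂ M N (≤₂ (K ℕ.⊔ L) _ hm)) (≤₂ M N (≤₂ (K ℕ.⊔ L) _ hn)))

    step₂ : ∀ {B C} → 0ℚ ℚ.< B → 0ℚ ℚ.< C →
            ∃[ K ] (∀ n → K ℕ.≤ n → ∣ x n ∣ ℚ.≤ B) →
            ∃[ L ] (∀ n → L ℕ.≤ n → ∣ y n ∣ ℚ.≤ C) →
            ∃[ b ] 0ℚ ℚ.< b × B ℚ.* b ≡ ½ ℚ.* e →
            ∃[ c ] 0ℚ ℚ.< c × C ℚ.* c ≡ ½ ℚ.* e →
            Goal
    step₂ 0<B 0<C hB hC (b , 0<b , Bb≡) (c , 0<c , Cc≡) =
      step₃ 0<B 0<C Bb≡ Cc≡ hB hC (cx c 0<c) (cy b 0<b)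

    step₁ : Bounded x → Bounded y → Goal
    step₁ (B , 0<B , hB) (C , 0<C , hC) =
      step₂ 0<B 0<C hB hC (shrink 0<B (0<½e 0<e)) (shrink 0<C (0<½e 0<e))

_*_ : ℝ → ℝ → ℝ
seq (x * y) n = seq x n ℚ.* seq y n
cauchy (x * y) e 0<e =
  Product.step₁ (cauchy x) (cauchy y) e 0<e
    (bounded (seq x) (cauchy x)) (bounded (seq y) (cauchy y))

-- Total, with junk value 0 at 0: the sequence of a positive real may still
-- vanish at finitely many indices.
invℚ : ℚ → ℚ
invℚ p with p ℚ.≟ 0ℚ
... | yes _  = 0ℚ
... | no p≢0 = (ℚ.1/ p) {{ℚ.≢-nonZero p≢0}}

private
  invℚ-inverse : ∀ {p} → 0ℚ ℚ.< p → p ℚ.* invℚ p ≡ 1ℚ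
  invℚ-inverse {p} 0<p with p ℚ.≟ 0ℚ
  ... | yes p≡0 = contradiction (sym p≡0) (ℚ.<⇒≢ 0<p)
  ... | no p≢0  = ℚ.*-inverseʳ p {{ℚ.≢-nonZero p≢0}}

  0<*-inv : ∀ {p u} → 0ℚ ℚ.< p → p ℚ.* u ≡ 1ℚ → 0ℚ ℚ.< u
  0<*-inv {p} {u} 0<p eq = ℚ.*-cancelˡ-<-nonNeg p {{ℚ.nonNegative (ℚ.<⇒≤ 0<p)}}
    (subst₂ ℚ._<_ (sym (ℚ.*-zeroʳ p)) (sym eq) (ℚ.positive⁻¹ 1ℚ))

  inv-bound : ∀ {d D p u} → d ℚ.* D ≡ 1ℚ → 0ℚ ℚ.< D → 0ℚ ℚ.< d →
              d ℚ.< p → p ℚ.* u ≡ 1ℚ → ∣ u ∣ ℚ.≤ D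
  inv-bound {d} {D} {p} {u} dD≡1 0<D 0<d d<p pu≡1 = begin
    ∣ u ∣            ≡⟨ ℚ.0≤p⇒∣p∣≡p (ℚ.<⇒≤ 0<u) ⟩
    u                ≡⟨ sym (ℚ.*-identityʳ u) ⟩
    u ℚ.* 1ℚ         ≡⟨ cong (u ℚ.*_) (sym dD≡1) ⟩
    u ℚ.* (d ℚ.* D)  ≡⟨ solve 3 (λ u d D → u :* (d :* D) := (u :* D) :* d) refl u d D ⟩
    (u ℚ.* D) ℚ.* d  ≤⟨ ℚ.*-monoˡ-≤-nonNeg (u ℚ.* D) {{ℚ.nonNegative (ℚ.<⇒≤ 0<uD)}} (ℚ.<⇒≤ d<p) ⟩
    (u ℚ.* D) ℚ.* p  ≡⟨ solve 3 (λ u D p → (u :* D) :* p := (p :* u) :* D) refl u D p ⟩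
    (p ℚ.* u) ℚ.* D  ≡⟨ cong (ℚ._* D) pu≡1 ⟩
    1ℚ ℚ.* D         ≡⟨ ℚ.*-identityˡ D ⟩
    D                ∎
    where
    open ℚ.≤-Reasoning
    0<u : 0ℚ ℚ.< u
    0<u = 0<*-inv (ℚ.<-trans 0<d d<p) pu≡1
    0<uD : 0ℚ ℚ.< u ℚ.* D
    0<uD = subst (ℚ._< u ℚ.* D) (ℚ.*-zeroˡ D) (ℚ.*-monoˡ-<-pos D {{ℚ.positive 0<D}} 0<u)

  inv-close : ∀ {d D b c e} p q → 0ℚ ℚ.< d → 0ℚ ℚ.< D → d ℚ.* D ≡ 1ℚ →
              D ℚ.* c ≡ e → D ℚ.* b ≡ c → d ℚ.< p → d ℚ.< q →
              ∣ q ℚ.- p ∣ ℚ.< b → ∣ invℚ p ℚ.- invℚ q ∣ ℚ.< e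
  inv-close {d} {D} {b} {c} {e} p q 0<d 0<D dD≡1 Dc≡e Db≡c d<p d<q hb =
    aux (invℚ p) (invℚ q) (invℚ-inverse (ℚ.<-trans 0<d d<p)) (invℚ-inverse (ℚ.<-trans 0<d d<q))
    where
    aux : ∀ u v → p ℚ.* u ≡ 1ℚ → q ℚ.* v ≡ 1ℚ → ∣ u ℚ.- v ∣ ℚ.< e
    aux u v pu≡1 qv≡1 = subst (λ z → ∣ z ∣ ℚ.< e) (sym diff)
      (∣*∣-mono-< u (v ℚ.* (q ℚ.- p)) 0<D Dc≡e (inv-bound dD≡1 0<D 0<d d<p pu≡1)
        (∣*∣-mono-< v (q ℚ.- p) 0<D Db≡c (inv-bound dD≡1 0<D 0<d d<q qv≡1) hb))
      where
      diff : u ℚ.- v ≡ u ℚ.* (v ℚ.* (q ℚ.- p))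
      diff = trans
        (cong₂ ℚ._-_ (trans (sym (ℚ.*-identityʳ u)) (cong (u ℚ.*_) (sym qv≡1)))
                     (trans (sym (ℚ.*-identityʳ v)) (cong (v ℚ.*_) (sym pu≡1))))
        (solve 4 (λ p q u v → u :* (q :* v) :- v :* (p :* u) := u :* (v :* (q :- p)))
          refl p q u v)

  inv-cauchy : ∀ x → 0ℝ < x → IsCauchy (λ n → invℚ (seq x n))
  inv-cauchy x (d , 0<d , K , hK) e 0<e = step₁ (shrink 0<d (ℚ.positive⁻¹ 1ℚ))
    where
    Goal : Set
    Goal = ∃[ N ] (∀ m n → N ℕ.≤ m → N ℕ.≤ n →
                   ∣ invℚ (seq x m) ℚ.- invℚ (seq x n) ∣ ℚ.< e)

    d<x : ∀ n → K ℕ.≤ n → d ℚ.< seq x n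
    d<x n K≤n = subst (ℚ._< seq x n) (ℚ.+-identityˡ d) (hK n K≤n)

    step₄ : ∀ {D b c} → 0ℚ ℚ.< D → d ℚ.* D ≡ 1ℚ → D ℚ.* c ≡ e → D ℚ.* b ≡ c →
            ∃[ N ] (∀ m n → N ℕ.≤ m → N ℕ.≤ n → ∣ seq x m ℚ.- seq x n ∣ ℚ.< b) → Goal
    step₄ 0<D dD≡1 Dc≡e Db≡c (N , hx) = K ℕ.⊔ N , λ m n hm hn →
      inv-close (seq x m) (seq x n) 0<d 0<D dD≡1 Dc≡e Db≡c
        (d<x m (≤₁ K N hm)) (d<x n (≤₁ K N hn)) (hx n m (≤₂ K N hn) (≤₂ K N hm))

    step₃ : ∀ {D c} → 0ℚ ℚ.< D → d ℚ.* D ≡ 1ℚ → D ℚ.* c ≡ e →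
            ∃[ b ] 0ℚ ℚ.< b × D ℚ.* b ≡ c → Goal
    step₃ 0<D dD≡1 Dc≡e (b , 0<b , Db≡c) = step₄ 0<D dD≡1 Dc≡e Db≡c (cauchy x b 0<b)

    step₂ : ∀ {D} → 0ℚ ℚ.< D → d ℚ.* D ≡ 1ℚ → ∃[ c ] 0ℚ ℚ.< c × D ℚ.* c ≡ e → Goal
    step₂ 0<D dD≡1 (c , 0<c , Dc≡e) = step₃ 0<D dD≡1 Dc≡e (shrink 0<D 0<c)

    step₁ : ∃[ D ] 0ℚ ℚ.< D × d ℚ.* D ≡ 1ℚ → Goal
    step₁ (D , 0<D , dD≡1) = step₂ 0<D dD≡1 (shrink 0<D 0<e)

infix 9 _⁻¹⟨_⟩

_⁻¹⟨_⟩ : (x : ℝ) → 0ℝ < x → ℝ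
seq    (x ⁻¹⟨ 0<x ⟩) n = invℚ (seq x n)
cauchy (x ⁻¹⟨ 0<x ⟩)   = inv-cauchy x 0<x

infixl 7 _/_⟨_⟩

_/_⟨_⟩ : ℝ → (y : ℝ) → 0ℝ < y → ℝ
x / y ⟨ 0<y ⟩ = x * y ⁻¹⟨ 0<y ⟩

0<+ : ∀ {x y} → 0ℝ < x → 0ℝ < y → 0ℝ < x + y
0<+ {x} {y} (d , 0<d , M , hx) (e , 0<e , N , hy) =
  d ℚ.+ e , ℚ.+-mono-< 0<d 0<e , M ℕ.⊔ N , λ n hn →
  subst (ℚ._< seq x n ℚ.+ seq y n)
    (solve 2 (λ d e → (con 0ℚ :+ d) :+ (con 0ℚ :+ e) := con 0ℚ :+ (d :+ e)) refl d e)
    (ℚ.+-mono-< (hx n (≤₁ M N hn)) (hy n (≤₂ M N hn)))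

record Parameters : Set where
  field
    α₁ α₂ α₄ α₅ : ℝ
    β₁ β₂ β₄ β₅ : ℝ
    0≤α₁ : 0ℝ ≤ α₁
    0≤α₂ : 0ℝ ≤ α₂
    0≤α₄ : 0ℝ ≤ α₄
    0≤α₅ : 0ℝ ≤ α₅
    0<β₁ : 0ℝ < β₁
    0<β₂ : 0ℝ < β₂
    0<β₄ : 0ℝ < β₄
    0<β₅ : 0ℝ < β₅

  α₁₂ α₄₅ β₁₂ β₄₅ α β : ℝ
  α₁₂ = α₁ + α₂
  α₄₅ = α₄ + α₅
  β₁₂ = β₁ + β₂
  β₄₅ = β₄ + β₅
  α   = α₄₅ - α₁₂
  β   = β₁ + β₂ + β₄ + β₅

  0<β₁₂ : 0ℝ < β₁₂
  0<β₁₂ = 0<+ {β₁} {β₂} 0<β₁ 0<β₂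

  0<β₄₅ : 0ℝ < β₄₅
  0<β₄₅ = 0<+ {β₄} {β₅} 0<β₄ 0<β₅

  0<β : 0ℝ < β
  0<β = 0<+ {β₁ + β₂ + β₄} {β₅} (0<+ {β₁ + β₂} {β₄} 0<β₁₂ 0<β₄) 0<β₅

data Node : Set where
  a b c d : Node

data Link : Node → Node → Set where
  ab : Link a b
  bd : Link b d
  ac : Link a c
  cd : Link c d

data Path : Set where
  P₁ P₂ : Path

route : Path → Star Link a d
route P₁ = ab ◅ bd ◅ ε
route P₂ = ac ◅ cd ◅ ε

pathThrough : ∀ {i j} → Link i j → Path
pathThrough ab = P₁
pathThrough bd = P₁
pathThrough ac = P₂
pathThrough cd = P₂

record IsFlow (Q : ℝ) (f : Path → ℝ) : Set where
  field
    nonNegative : ∀ P → 0ℝ ≤ f P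
    total       : f P₁ + f P₂ ≈ Q

module _ (N : Parameters) where
  open Parameters N

  linkTime : ∀ {i j} → Link i j → ℝ → ℝ
  linkTime ab x = α₁ + β₁ * x
  linkTime bd x = α₂ + β₂ * x
  linkTime ac x = α₄ + β₄ * x
  linkTime cd x = α₅ + β₅ * x

  linkFlow : (Path → ℝ) → ∀ {i j} → Link i j → ℝ
  linkFlow f l = f (pathThrough l)

  routeTime : (Path → ℝ) → ∀ {i j} → Star Link i j → ℝ
  routeTime f ε       = 0ℝ
  routeTime f (l ◅ r) = linkTime l (linkFlow f l) + routeTime f r

  pathTime : (Path → ℝ) → Path → ℝ
  pathTime f P = routeTime f (route P)

  Vanishing : (Path → ℝ) → Path → Set
  Vanishing f P = f P ≈ 0ℝ

  -- f is an equilibrium flow of total amount Q with common travel time T.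
  record IsEquilibrium (Q : ℝ) (f : Path → ℝ) (T : ℝ) : Set where
    field
      isFlow       : IsFlow Q f
      nonVanishing : ∀ P → ¬ Vanishing f P → pathTime f P ≈ T
      vanishing    : ∀ P → Vanishing f P → T ≤ pathTime f P

  -- T_Eq = T, reading T_Eq as a definite description: T is the common travel
  -- time of some equilibrium, and of every equilibrium.
  IsEquilibriumTime : ℝ → ℝ → Set
  IsEquilibriumTime Q T =
    (∃[ f ] IsEquilibrium Q f T) × (∀ f T′ → IsEquilibrium Q f T′ → T′ ≈ T)

{-# OPTIONS --safe #-}
-- Existence: the candidate flows are (0, Q), (Q, 0) and (p, Q − p) with
-- p = (α + Q β₄₅) / β; in the last case β p ≈ α + Q β₄₅ makes both travel times
-- agree.  Multiplying out the denominators turns the hypothesis of each case into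
-- the inequality that its flow needs.
--
-- Uniqueness: let f and g be equilibria for the same Q with times T < T′.  On a
-- path P with g P ≤ f P the flow f must vanish, since otherwise
-- T′ ≤ t_g(P) ≤ t_f(P) ≈ T.  Hence f ≤ g on both paths, so f ≈ g by equality of
-- the totals, so f vanishes on both paths, against 0 < Q.
--
-- All of this is done by contradiction, which is legitimate because ≤ is a
-- negation and ≈ is the conjunction of both inequalities.
module Submission where

open import Defs
open import Data.Empty using (⊥-elim)
open import Data.Nat.Base as ℕ using (ℕ)
import Data.Nat.Properties as ℕ
open import Data.Product using (∃-syntax; _×_; _,_)
open import Data.Rational.Base as ℚ using (ℚ; 0ℚ; 1ℚ; ½; ∣_∣)
import Data.Rational.Properties as ℚ
open import Data.Rational.Solver using (module +-*-Solver)
open import Relation.Binary.PropositionalEquality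
  using (_≡_; refl; sym; trans; cong; cong₂; subst; subst₂)
open import Relation.Binary.Structures using (IsPreorder)
import Relation.Binary.Reasoning.Base.Triple as Triple
open import Relation.Nullary using (¬_; Dec; yes; no; contradiction)

open +-*-Solver using (solve; _:+_; _:-_; _:*_; :-_; _:=_; con)
open Estimates

-- Rational preliminaries

-- Reduces a linear inequality to a known one plus a ring identity between the two differences,
-- which the solver checks.
<-resp-difference : ∀ {p q r s} → s ℚ.- r ≡ q ℚ.- p → r ℚ.< s → p ℚ.< q
<-resp-difference {p} {q} {r} {s} eq r<s = subst₂ ℚ._<_
  (solve 2 (λ p r → p :- r :+ r := p) refl p r)
  (trans (solve 3 (λ p r s → p :- r :+ s := p :+ (s :- r)) refl p r s)
    (trans (cong (p ℚ.+_) eq) (solve 2 (λ p q → p :+ (q :- p) := q) refl p q)))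
  (ℚ.+-monoʳ-< (p ℚ.- r) r<s)

p<p+q : ∀ {p q} → 0ℚ ℚ.< q → p ℚ.< p ℚ.+ q
p<p+q {p} {q} 0<q = subst (ℚ._< p ℚ.+ q) (ℚ.+-identityʳ p) (ℚ.+-monoʳ-< p 0<q)

∣p-q∣<e⇒p<q+e : ∀ p q {e} → ∣ p ℚ.- q ∣ ℚ.< e → p ℚ.< q ℚ.+ e
∣p-q∣<e⇒p<q+e p q {e} h = <-resp-difference
  (solve 3 (λ p q e → e :- (p :- q) := q :+ e :- p) refl p q e)
  (ℚ.≤-<-trans (p≤∣p∣ (p ℚ.- q)) h)

invℚ-inverseʳ : ∀ {p} → 0ℚ ℚ.< p → p ℚ.* invℚ p ≡ 1ℚ
invℚ-inverseʳ {p} 0<p with p ℚ.≟ 0ℚ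
... | yes p≡0 = contradiction (sym p≡0) (ℚ.<⇒≢ 0<p)
... | no p≢0  = ℚ.*-inverseʳ p {{ℚ.≢-nonZero p≢0}}

-- Order on ℝ

Eventually : (ℕ → Set) → Set
Eventually P = ∃[ N ] (∀ n → N ℕ.≤ n → P n)

eventually-map : ∀ {P R} → (∀ n → P n → R n) → Eventually P → Eventually R
eventually-map f (N , h) = N , λ n N≤n → f n (h n N≤n)

eventually-zip : ∀ {P R S} → (∀ n → P n → R n → S n) →
                 Eventually P → Eventually R → Eventually S
eventually-zip f (M , h) (N , k) = M ℕ.⊔ N , λ n hn →
  f n (h n (ℕ.m⊔n≤o⇒m≤o M N hn)) (k n (ℕ.m⊔n≤o⇒n≤o M N hn))

eventually-disjoint : ∀ {P R} → (∀ n → P n → ¬ R n) → Eventually P → ¬ Eventually R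
eventually-disjoint f (M , h) (N , k) =
  f (M ℕ.⊔ N) (h (M ℕ.⊔ N) (ℕ.m≤m⊔n M N)) (k (M ℕ.⊔ N) (ℕ.m≤n⊔m M N))

-- Stated for sequences, so that both sides of an equation between reals are
-- inferred: unification never has to recover a Cauchy proof.
eventually-≡⇒≈ : ∀ {s t : ℕ → ℚ} → Eventually (λ n → s n ≡ t n) →
  ∀ e → 0ℚ ℚ.< e → Eventually (λ n → ∣ s n ℚ.- t n ∣ ℚ.< e)
eventually-≡⇒≈ {s} {t} s≡t e 0<e = eventually-map
  (λ n sₙ≡tₙ → subst (λ p → ∣ p ∣ ℚ.< e)
    (sym (trans (cong (ℚ._- t n) sₙ≡tₙ) (ℚ.+-inverseʳ (t n)))) 0<e)
  s≡t

≡⇒≈ : ∀ {s t : ℕ → ℚ} → (∀ n → s n ≡ t n) →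
  ∀ e → 0ℚ ℚ.< e → Eventually (λ n → ∣ s n ℚ.- t n ∣ ℚ.< e)
≡⇒≈ s≡t = eventually-≡⇒≈ (0 , λ n _ → s≡t n)

≈-refl : ∀ x → x ≈ x
≈-refl x = ≡⇒≈ {seq x} (λ _ → refl)

≈-sym : ∀ x y → x ≈ y → y ≈ x
≈-sym x y x≈y e 0<e = eventually-map
  (λ n → subst (ℚ._< e) (∣p-q∣≡∣q-p∣ (seq x n) (seq y n))) (x≈y e 0<e)

-- Constructively valid because one rational comparison, at an index K past both
-- Cauchy moduli, decides between y < x and the conclusion.
≤⇒eventually-<+ : ∀ x y → x ≤ y → ∀ e → 0ℚ ℚ.< e →
  Eventually (λ n → seq x n ℚ.< seq y n ℚ.+ e)
≤⇒eventually-<+ x y x≤y e 0<e = eventually-map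
  (λ n → subst (λ p → seq x n ℚ.< seq y n ℚ.+ p) 4δ≡e)
  (fromModuli δ (cauchy x δ 0<δ) (cauchy y δ 0<δ))
  where
  -- A quarter of `e`: if the terms at `K` differ by at most `2δ`, moving each of `x` and `y` from
  -- index `K` to `n` costs one more `δ`.
  δ = ½ ℚ.* (½ ℚ.* e)

  0<δ : 0ℚ ℚ.< δ
  0<δ = 0<½e (0<½e 0<e)

  4δ≡e : (δ ℚ.+ δ) ℚ.+ (δ ℚ.+ δ) ≡ e
  4δ≡e = trans (cong₂ ℚ._+_ (halves (½ ℚ.* e)) (halves (½ ℚ.* e))) (halves e)

  compare : ∀ δ K → (∀ m n → K ℕ.≤ m → K ℕ.≤ n → seq x m ℚ.< seq x n ℚ.+ δ) →
                    (∀ m n → K ℕ.≤ m → K ℕ.≤ n → seq y m ℚ.< seq y n ℚ.+ δ) →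
            Dec (δ ℚ.+ δ ℚ.< seq x K ℚ.- seq y K) →
            Eventually (λ n → seq x n ℚ.< seq y n ℚ.+ ((δ ℚ.+ δ) ℚ.+ (δ ℚ.+ δ)))
  compare δ K x-near y-near (yes far) = ⊥-elim (x≤y (gap , 0<gap , K , y+gap<x))
    where
    gap = seq x K ℚ.- seq y K ℚ.- (δ ℚ.+ δ)
    0<gap : 0ℚ ℚ.< gap
    0<gap = <-resp-difference
      (solve 2 (λ g h → g :- h := g :- h :- con 0ℚ) refl (seq x K ℚ.- seq y K) (δ ℚ.+ δ)) far
    y+gap<x : ∀ n → K ℕ.≤ n → seq y n ℚ.+ gap ℚ.< seq x n
    y+gap<x n K≤n = <-resp-difference
      (solve 5 (λ xK yK xn yn δ →
         (xn :+ δ) :+ (yK :+ δ) :- (xK :+ yn) := xn :- (yn :+ (xK :- yK :- (δ :+ δ))))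
         refl (seq x K) (seq y K) (seq x n) (seq y n) δ)
      (ℚ.+-mono-< (x-near K n ℕ.≤-refl K≤n) (y-near n K K≤n ℕ.≤-refl))
  compare δ K x-near y-near (no near) = K , λ n K≤n → <-resp-difference
    (solve 5 (λ xK yK xn yn δ →
       (xK :+ δ) :+ (yn :+ δ) :+ (δ :+ δ) :- (xn :+ yK :+ (xK :- yK))
       := yn :+ ((δ :+ δ) :+ (δ :+ δ)) :- xn)
       refl (seq x K) (seq y K) (seq x n) (seq y n) δ)
    (ℚ.+-mono-<-≤ (ℚ.+-mono-< (x-near n K K≤n ℕ.≤-refl) (y-near K n ℕ.≤-refl K≤n))
                  (ℚ.≮⇒≥ near))

  fromModuli : ∀ δ →
    ∃[ M ] (∀ m n → M ℕ.≤ m → M ℕ.≤ n → ∣ seq x m ℚ.- seq x n ∣ ℚ.< δ) →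
    ∃[ N ] (∀ m n → N ℕ.≤ m → N ℕ.≤ n → ∣ seq y m ℚ.- seq y n ∣ ℚ.< δ) →
    Eventually (λ n → seq x n ℚ.< seq y n ℚ.+ ((δ ℚ.+ δ) ℚ.+ (δ ℚ.+ δ)))
  fromModuli δ (M , hx) (N , hy) = compare δ (M ℕ.⊔ N)
    (λ m n hm hn → ∣p-q∣<e⇒p<q+e (seq x m) (seq x n)
      (hx m n (ℕ.m⊔n≤o⇒m≤o M N hm) (ℕ.m⊔n≤o⇒m≤o M N hn)))
    (λ m n hm hn → ∣p-q∣<e⇒p<q+e (seq y m) (seq y n)
      (hy m n (ℕ.m⊔n≤o⇒n≤o M N hm) (ℕ.m⊔n≤o⇒n≤o M N hn)))
    (δ ℚ.+ δ ℚ.<? seq x (M ℕ.⊔ N) ℚ.- seq y (M ℕ.⊔ N))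

≤-antisym : ∀ x y → x ≤ y → y ≤ x → x ≈ y
≤-antisym x y x≤y y≤x e 0<e = eventually-zip
  (λ n x<y+e y<x+e → ∣p∣<e
    (<-resp-difference (solve 3 (λ p q e → q :+ e :- p := e :- (p :- q))
       refl (seq x n) (seq y n) e) x<y+e)
    (<-resp-difference (solve 3 (λ p q e → p :+ e :- q := e :- (:- (p :- q)))
       refl (seq x n) (seq y n) e) y<x+e))
  (≤⇒eventually-<+ x y x≤y e 0<e) (≤⇒eventually-<+ y x y≤x e 0<e)

≈⇒≤ : ∀ x y → x ≈ y → x ≤ y
≈⇒≤ x y x≈y (e , 0<e , y+e<x) = eventually-disjoint
  (λ n y+e<xₙ ∣x-y∣<e → ℚ.<-asym y+e<xₙ (∣p-q∣<e⇒p<q+e (seq x n) (seq y n) ∣x-y∣<e))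
  y+e<x (x≈y e 0<e)

-- Half of the separation `e` absorbs the error allowed by `x ≤ y`; the other half remains as the
-- new separation.
≤-<-trans : ∀ x y z → x ≤ y → y < z → x < z
≤-<-trans x y z x≤y (e , 0<e , y+e<z) = ½ ℚ.* e , 0<½e 0<e , eventually-zip
  (λ n y+e<zₙ x<y+½e → add (seq x n) (seq y n) (seq z n) (½ ℚ.* e)
    (subst (λ p → seq y n ℚ.+ p ℚ.< seq z n) (sym (halves e)) y+e<zₙ) x<y+½e)
  y+e<z (≤⇒eventually-<+ x y x≤y (½ ℚ.* e) (0<½e 0<e))
  where
  add : ∀ p q r h → q ℚ.+ (h ℚ.+ h) ℚ.< r → p ℚ.< q ℚ.+ h → p ℚ.+ h ℚ.< r
  add p q r h q+2h<r p<q+h = <-resp-difference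
    (solve 4 (λ p q r h → (r :+ (q :+ h)) :- ((q :+ (h :+ h)) :+ p) := r :- (p :+ h))
       refl p q r h)
    (ℚ.+-mono-< q+2h<r p<q+h)

<-≤-trans : ∀ x y z → x < y → y ≤ z → x < z
<-≤-trans x y z (e , 0<e , x+e<y) y≤z = ½ ℚ.* e , 0<½e 0<e , eventually-zip
  (λ n x+e<yₙ y<z+½e → add (seq x n) (seq y n) (seq z n) (½ ℚ.* e)
    (subst (λ p → seq x n ℚ.+ p ℚ.< seq y n) (sym (halves e)) x+e<yₙ) y<z+½e)
  x+e<y (≤⇒eventually-<+ y z y≤z (½ ℚ.* e) (0<½e 0<e))
  where
  add : ∀ p q r h → p ℚ.+ (h ℚ.+ h) ℚ.< q → q ℚ.< r ℚ.+ h → p ℚ.+ h ℚ.< r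
  add p q r h p+2h<q q<r+h = <-resp-difference
    (solve 4 (λ p q r h → (q :+ (r :+ h)) :- ((p :+ (h :+ h)) :+ q) := r :- (p :+ h))
       refl p q r h)
    (ℚ.+-mono-< p+2h<q q<r+h)

<-irrefl : ∀ x → ¬ x < x
<-irrefl x = ≈⇒≤ x x (≈-refl x)

<-asym : ∀ x y → x < y → ¬ y < x
<-asym x y (δ , 0<δ , x+δ<y) (ε , 0<ε , y+ε<x) = eventually-disjoint
  (λ n x+δ<yₙ y+ε<xₙ →
    ℚ.<-asym (ℚ.<-trans (p<p+q 0<δ) x+δ<yₙ) (ℚ.<-trans (p<p+q 0<ε) y+ε<xₙ))
  x+δ<y y+ε<x

<⇒≤ : ∀ x y → x < y → x ≤ y
<⇒≤ = <-asym

≤-trans : ∀ x y z → x ≤ y → y ≤ z → x ≤ z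
≤-trans x y z x≤y y≤z z<x = y≤z (<-≤-trans z x y z<x x≤y)

≈-trans : ∀ x y z → x ≈ y → y ≈ z → x ≈ z
≈-trans x y z x≈y y≈z = ≤-antisym x z
  (≤-trans x y z (≈⇒≤ x y x≈y) (≈⇒≤ y z y≈z))
  (≤-trans z y x (≈⇒≤ z y (≈-sym y z y≈z)) (≈⇒≤ y x (≈-sym x y x≈y)))

≤-isPreorder : IsPreorder _≈_ _≤_
≤-isPreorder = record
  { isEquivalence = record
    { refl  = λ {x} → ≈-refl x
    ; sym   = λ {x} {y} → ≈-sym x y
    ; trans = λ {x} {y} {z} → ≈-trans x y z
    }
  ; reflexive = λ {x} {y} → ≈⇒≤ x y
  ; trans     = λ {x} {y} {z} → ≤-trans x y z
  }

module ≤-Reasoning = Triple ≤-isPreorder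
  (λ {x} {y} → <-asym x y)
  (λ {x} {y} {z} x<y y<z → <-≤-trans x y z x<y (<⇒≤ y z y<z))
  ( (λ {x} {y} {z} y≈z x<y → <-≤-trans x y z x<y (≈⇒≤ y z y≈z))
  , (λ {x} {y} {z} y≈z y<x → ≤-<-trans z y x (≈⇒≤ z y (≈-sym y z y≈z)) y<x))
  (λ {x} {y} → <⇒≤ x y)
  (λ {x} {y} {z} → <-≤-trans x y z)
  (λ {x} {y} {z} → ≤-<-trans x y z)

-- Ordered field laws

+-monoʳ-< : ∀ z x y → x < y → z + x < z + y
+-monoʳ-< z x y (e , 0<e , x+e<y) = e , 0<e , eventually-map
  (λ n → <-resp-difference
    (solve 4 (λ x y z e → y :- (x :+ e) := z :+ y :- (z :+ x :+ e))
      refl (seq x n) (seq y n) (seq z n) e))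
  x+e<y

+-cancelˡ-< : ∀ z x y → z + x < z + y → x < y
+-cancelˡ-< z x y (e , 0<e , z+x+e<z+y) = e , 0<e , eventually-map
  (λ n → <-resp-difference
    (solve 4 (λ x y z e → z :+ y :- (z :+ x :+ e) := y :- (x :+ e))
      refl (seq x n) (seq y n) (seq z n) e))
  z+x+e<z+y

+-monoʳ-≤ : ∀ z x y → x ≤ y → z + x ≤ z + y
+-monoʳ-≤ z x y x≤y z+y<z+x = x≤y (+-cancelˡ-< z y x z+y<z+x)

-- Monotonicity in both directions and antisymmetry replace an epsilon estimate.
+-congˡ : ∀ z x y → x ≈ y → z + x ≈ z + y
+-congˡ z x y x≈y = ≤-antisym (z + x) (z + y)
  (+-monoʳ-≤ z x y (≈⇒≤ x y x≈y))
  (+-monoʳ-≤ z y x (≈⇒≤ y x (≈-sym x y x≈y)))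

+-comm : ∀ x y → x + y ≈ y + x
+-comm x y = ≡⇒≈ (λ n → ℚ.+-comm (seq x n) (seq y n))

+-identityʳ : ∀ x → x + 0ℝ ≈ x
+-identityʳ x = ≡⇒≈ (λ n → ℚ.+-identityʳ (seq x n))

x+[y-x]≈y : ∀ x y → x + (y - x) ≈ y
x+[y-x]≈y x y = ≡⇒≈ λ n →
  solve 2 (λ p q → p :+ (q :- p) := q) refl (seq x n) (seq y n)

+-cong : ∀ x x′ y y′ → x ≈ x′ → y ≈ y′ → x + y ≈ x′ + y′
+-cong x x′ y y′ x≈x′ y≈y′ = begin-equality
  x + y    ≈⟨ +-congˡ x y y′ y≈y′ ⟩
  x + y′   ≈⟨ +-comm x y′ ⟩
  y′ + x   ≈⟨ +-congˡ y′ x x′ x≈x′ ⟩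
  y′ + x′  ≈⟨ +-comm y′ x′ ⟩
  x′ + y′  ∎
  where open ≤-Reasoning

+-mono-<-≤ : ∀ x x′ y y′ → x < x′ → y ≤ y′ → x + y < x′ + y′
+-mono-<-≤ x x′ y y′ x<x′ y≤y′ = begin-strict
  x + y    ≈⟨ +-comm x y ⟩
  y + x    <⟨ +-monoʳ-< y x x′ x<x′ ⟩
  y + x′   ≈⟨ +-comm y x′ ⟩
  x′ + y   ≤⟨ +-monoʳ-≤ x′ y y′ y≤y′ ⟩
  x′ + y′  ∎
  where open ≤-Reasoning

-- Multiplication and division by positive reals

eventually-positive : ∀ {x} → 0ℝ < x →
  ∃[ e ] 0ℚ ℚ.< e × Eventually (λ n → e ℚ.< seq x n)
eventually-positive {x} (e , 0<e , 0+e<x) =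
  e , 0<e , eventually-map (λ n → subst (ℚ._< seq x n) (ℚ.+-identityˡ e)) 0+e<x

eventually-bounded-above : ∀ x → ∃[ B ] 0ℚ ℚ.< B × Eventually (λ n → seq x n ℚ.≤ B)
eventually-bounded-above x = fromModulus (cauchy x 1ℚ (ℚ.positive⁻¹ 1ℚ))
  where
  fromModulus : ∃[ N ] (∀ m n → N ℕ.≤ m → N ℕ.≤ n → ∣ seq x m ℚ.- seq x n ∣ ℚ.< 1ℚ) →
                ∃[ B ] 0ℚ ℚ.< B × Eventually (λ n → seq x n ℚ.≤ B)
  fromModulus (N , h) =
    ∣ seq x N ∣ ℚ.+ 1ℚ
    , ℚ.+-mono-≤-< (ℚ.0≤∣p∣ (seq x N)) (ℚ.positive⁻¹ 1ℚ)
    , N , λ n N≤n → ℚ.≤-trans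
        (ℚ.<⇒≤ (∣p-q∣<e⇒p<q+e (seq x n) (seq x N) (h n N N≤n ℕ.≤-refl)))
        (ℚ.+-monoˡ-≤ 1ℚ (p≤∣p∣ (seq x N)))

-- If `δ` is an eventual lower bound of `z` and `e` separates `x` from `y`, then `δ * e` separates
-- the products.
*-monoʳ-< : ∀ z x y → 0ℝ < z → x < y → z * x < z * y
*-monoʳ-< z x y 0<z (e , 0<e , x+e<y) = scale (eventually-positive {z} 0<z)
  where
  open ℚ.≤-Reasoning
  bound : ∀ {δ} p q r → 0ℚ ℚ.< δ → δ ℚ.< r → p ℚ.+ e ℚ.< q →
          r ℚ.* p ℚ.+ δ ℚ.* e ℚ.< r ℚ.* q
  bound {δ} p q r 0<δ δ<r p+e<q = begin-strict
    r ℚ.* p ℚ.+ δ ℚ.* e  <⟨ ℚ.+-monoʳ-< (r ℚ.* p) (ℚ.*-monoˡ-<-pos e {{ℚ.positive 0<e}} δ<r) ⟩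
    r ℚ.* p ℚ.+ r ℚ.* e  ≡⟨ ℚ.*-distribˡ-+ r p e ⟨
    r ℚ.* (p ℚ.+ e)      <⟨ ℚ.*-monoʳ-<-pos r {{ℚ.positive (ℚ.<-trans 0<δ δ<r)}} p+e<q ⟩
    r ℚ.* q              ∎
  scale : ∃[ δ ] 0ℚ ℚ.< δ × Eventually (λ n → δ ℚ.< seq z n) → z * x < z * y
  scale (δ , 0<δ , δ<z) =
    δ ℚ.* e
    , subst (ℚ._< δ ℚ.* e) (ℚ.*-zeroʳ δ) (ℚ.*-monoʳ-<-pos δ {{ℚ.positive 0<δ}} 0<e)
    , eventually-zip (λ n → bound (seq x n) (seq y n) (seq z n) 0<δ) δ<z x+e<y

-- With `B` an eventual upper bound of `z`, the separation that survives cancellation is `e / B`.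
*-cancelˡ-< : ∀ z x y → 0ℝ < z → z * x < z * y → x < y
*-cancelˡ-< z x y 0<z (e , 0<e , zx+e<zy) =
  unscale (eventually-positive {z} 0<z) (eventually-bounded-above z)
  where
  open ℚ.≤-Reasoning
  bound : ∀ {B ε} p q r → B ℚ.* ε ≡ e → 0ℚ ℚ.< ε → 0ℚ ℚ.< r → r ℚ.≤ B →
          r ℚ.* p ℚ.+ e ℚ.< r ℚ.* q → p ℚ.+ ε ℚ.< q
  bound {B} {ε} p q r Bε≡e 0<ε 0<r r≤B rp+e<rq =
    ℚ.*-cancelˡ-<-nonNeg r {{ℚ.nonNegative (ℚ.<⇒≤ 0<r)}} (begin-strict
      r ℚ.* (p ℚ.+ ε)      ≡⟨ ℚ.*-distribˡ-+ r p ε ⟩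
      r ℚ.* p ℚ.+ r ℚ.* ε  ≤⟨ ℚ.+-monoʳ-≤ (r ℚ.* p)
                                (ℚ.*-monoʳ-≤-nonNeg ε {{ℚ.nonNegative (ℚ.<⇒≤ 0<ε)}} r≤B) ⟩
      r ℚ.* p ℚ.+ B ℚ.* ε  ≡⟨ cong (r ℚ.* p ℚ.+_) Bε≡e ⟩
      r ℚ.* p ℚ.+ e        <⟨ rp+e<rq ⟩
      r ℚ.* q              ∎)
  unscale : ∃[ δ ] 0ℚ ℚ.< δ × Eventually (λ n → δ ℚ.< seq z n) →
            ∃[ B ] 0ℚ ℚ.< B × Eventually (λ n → seq z n ℚ.≤ B) → x < y
  unscale (δ , 0<δ , δ<z) (B , 0<B , z≤B) = conclude (shrink 0<B 0<e)
    where
    conclude : ∃[ ε ] 0ℚ ℚ.< ε × B ℚ.* ε ≡ e → x < y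
    conclude (ε , 0<ε , Bε≡e) = ε , 0<ε , eventually-zip
      (λ n zx+e<zyₙ (δ<zₙ , zₙ≤B) → bound (seq x n) (seq y n) (seq z n) Bε≡e 0<ε
        (ℚ.<-trans 0<δ δ<zₙ) zₙ≤B zx+e<zyₙ)
      zx+e<zy (eventually-zip (λ _ → _,_) δ<z z≤B)

*-monoʳ-≤ : ∀ z x y → 0ℝ < z → x ≤ y → z * x ≤ z * y
*-monoʳ-≤ z x y 0<z x≤y zy<zx = x≤y (*-cancelˡ-< z y x 0<z zy<zx)

-- The terms agree only from some index on: before it a term of `y` may be zero, where `invℚ` takes
-- its default value.
*-/-cancel : ∀ x y (0<y : 0ℝ < y) → y * (x / y ⟨ 0<y ⟩) ≈ x
*-/-cancel x y 0<y = fromBound (eventually-positive {y} 0<y)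
  where
  cancel : ∀ p q → 0ℚ ℚ.< q → q ℚ.* (p ℚ.* invℚ q) ≡ p
  cancel p q 0<q = trans
    (solve 3 (λ p q u → q :* (p :* u) := p :* (q :* u)) refl p q (invℚ q))
    (trans (cong (p ℚ.*_) (invℚ-inverseʳ 0<q)) (ℚ.*-identityʳ p))
  fromBound : ∃[ δ ] 0ℚ ℚ.< δ × Eventually (λ n → δ ℚ.< seq y n) → y * (x / y ⟨ 0<y ⟩) ≈ x
  fromBound (δ , 0<δ , δ<y) = eventually-≡⇒≈
    (eventually-map (λ n δ<yₙ → cancel (seq x n) (seq y n) (ℚ.<-trans 0<δ δ<yₙ)) δ<y)

*-/-assoc : ∀ z x y (0<y : 0ℝ < y) → z * (x / y ⟨ 0<y ⟩) ≈ x * z / y ⟨ 0<y ⟩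
*-/-assoc z x y 0<y = ≡⇒≈ λ n → solve 3 (λ z x u → z :* (x :* u) := x :* z :* u) refl
  (seq z n) (seq x n) (invℚ (seq y n))

-- A hypothesis `Q ≤ x / y` is the negation of `x / y < Q`, so refuting it requires exactly this
-- direction.
/-<⇐<-* : ∀ x y z (0<y : 0ℝ < y) → x < y * z → x / y ⟨ 0<y ⟩ < z
/-<⇐<-* x y z 0<y x<yz = *-cancelˡ-< y (x / y ⟨ 0<y ⟩) z 0<y (begin-strict
  y * (x / y ⟨ 0<y ⟩)  ≈⟨ *-/-cancel x y 0<y ⟩
  x                    <⟨ x<yz ⟩
  y * z                ∎)
  where open ≤-Reasoning

<-/⇐*-< : ∀ x y z (0<y : 0ℝ < y) → y * z < x → z < x / y ⟨ 0<y ⟩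
<-/⇐*-< x y z 0<y yz<x = *-cancelˡ-< y z (x / y ⟨ 0<y ⟩) 0<y (begin-strict
  y * z                <⟨ yz<x ⟩
  x                    ≈⟨ *-/-cancel x y 0<y ⟨
  y * (x / y ⟨ 0<y ⟩)  ∎)
  where open ≤-Reasoning

-- Maximum

x≤x⊔y : ∀ x y → x ≤ x ⊔ y
x≤x⊔y x y (e , 0<e , N , h) = ℚ.<-asym (p<p+q 0<e)
  (ℚ.<-≤-trans (h N ℕ.≤-refl) (ℚ.p≤p⊔q (seq x N) (seq y N)))

y≤x⊔y : ∀ x y → y ≤ x ⊔ y
y≤x⊔y x y (e , 0<e , N , h) = ℚ.<-asym (p<p+q 0<e)
  (ℚ.<-≤-trans (h N ℕ.≤-refl) (ℚ.p≤q⊔p (seq x N) (seq y N)))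

-- Equilibria

splitFlow : ℝ → ℝ → Path → ℝ
splitFlow x y P₁ = x
splitFlow x y P₂ = y

module _ (N : Parameters) where
  open Parameters N

  offset slope : Path → ℝ
  offset P₁ = α₁₂
  offset P₂ = α₄₅
  slope P₁ = β₁₂
  slope P₂ = β₄₅

  0<slope : ∀ P → 0ℝ < slope P
  0<slope P₁ = 0<β₁₂
  0<slope P₂ = 0<β₄₅

  -- Both links of a path carry the same flow, so their coefficients add up. The `con 0ℚ` is the
  -- time of the empty rest of the route.
  pathTime-affine : ∀ f P → pathTime N f P ≈ offset P + slope P * f P
  pathTime-affine f P₁ = ≡⇒≈ λ n →
    solve 5 (λ o₁ s₁ o₂ s₂ x →
      (o₁ :+ s₁ :* x) :+ ((o₂ :+ s₂ :* x) :+ con 0ℚ) := (o₁ :+ o₂) :+ (s₁ :+ s₂) :* x)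
      refl (seq α₁ n) (seq β₁ n) (seq α₂ n) (seq β₂ n) (seq (f P₁) n)
  pathTime-affine f P₂ = ≡⇒≈ λ n →
    solve 5 (λ o₁ s₁ o₂ s₂ x →
      (o₁ :+ s₁ :* x) :+ ((o₂ :+ s₂ :* x) :+ con 0ℚ) := (o₁ :+ o₂) :+ (s₁ :+ s₂) :* x)
      refl (seq α₄ n) (seq β₄ n) (seq α₅ n) (seq β₅ n) (seq (f P₂) n)

  pathTime-mono : ∀ f g P → f P ≤ g P → pathTime N f P ≤ pathTime N g P
  pathTime-mono f g P fP≤gP = begin
    pathTime N f P            ≈⟨ pathTime-affine f P ⟩
    offset P + slope P * f P  ≤⟨ +-monoʳ-≤ (offset P) (slope P * f P) (slope P * g P)
                                   (*-monoʳ-≤ (slope P) (f P) (g P) (0<slope P) fP≤gP) ⟩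
    offset P + slope P * g P  ≈⟨ pathTime-affine g P ⟨
    pathTime N g P            ∎
    where open ≤-Reasoning

  -- Whether `f P` vanishes need not be decided: if the path were faster than `T`, it could not
  -- vanish, hence its time would be `T`.
  time≤pathTime : ∀ {Q f T} → IsEquilibrium N Q f T → ∀ P → T ≤ pathTime N f P
  time≤pathTime {f = f} {T} F P t<T = ≈⇒≤ T (pathTime N f P)
    (≈-sym (pathTime N f P) T (nonVanishing P λ v → vanishing P v t<T)) t<T
    where open IsEquilibrium F

  -- Uniqueness of the travel time

  equilibriumTime-≤ : ∀ {Q f g T T′} → 0ℝ < Q →
    IsEquilibrium N Q f T → IsEquilibrium N Q g T′ → T′ ≤ T
  equilibriumTime-≤ {Q} {f} {g} {T} {T′} 0<Q F G T<T′ =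
    -- Vanishing is known only up to double negation, which suffices because the goal is absurdity.
    vanishes P₁ g≤f₁ λ f₁≈0 → vanishes P₂ g≤f₂ λ f₂≈0 → <-irrefl 0ℝ (begin-strict
      0ℝ           <⟨ 0<Q ⟩
      Q            ≈⟨ F.total ⟨
      f P₁ + f P₂  ≈⟨ +-cong (f P₁) 0ℝ (f P₂) 0ℝ f₁≈0 f₂≈0 ⟩
      0ℝ + 0ℝ      ≈⟨ +-identityʳ 0ℝ ⟩
      0ℝ           ∎)
    where
    open ≤-Reasoning
    module F where
      open IsEquilibrium F public
      open IsFlow isFlow public
    module G where
      open IsEquilibrium G public
      open IsFlow isFlow public

    vanishes : ∀ P → g P ≤ f P → ¬ ¬ Vanishing N f P
    vanishes P gP≤fP f≉0 = <-irrefl T (begin-strict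
      T               <⟨ T<T′ ⟩
      T′              ≤⟨ time≤pathTime G P ⟩
      pathTime N g P  ≤⟨ pathTime-mono g f P gP≤fP ⟩
      pathTime N f P  ≈⟨ F.nonVanishing P f≉0 ⟩
      T               ∎)

    f≤g : ∀ P → f P ≤ g P
    -- If `g P < f P`, then `f P` vanishes and `g P` would be negative.
    f≤g P gP<fP = vanishes P (<⇒≤ (g P) (f P) gP<fP) λ f≈0 → G.nonNegative P (begin-strict
      g P  <⟨ gP<fP ⟩
      f P  ≈⟨ f≈0 ⟩
      0ℝ   ∎)

    g≤f₁ : g P₁ ≤ f P₁
    -- A strict gain on one path and `f ≤ g` on the other would make the two totals differ.
    g≤f₁ f₁<g₁ = <-irrefl Q (begin-strict
      Q            ≈⟨ F.total ⟨
      f P₁ + f P₂  <⟨ +-mono-<-≤ (f P₁) (g P₁) (f P₂) (g P₂) f₁<g₁ (f≤g P₂) ⟩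
      g P₁ + g P₂  ≈⟨ G.total ⟩
      Q            ∎)

    g≤f₂ : g P₂ ≤ f P₂
    g≤f₂ f₂<g₂ = <-irrefl Q (begin-strict
      Q            ≈⟨ F.total ⟨
      f P₁ + f P₂  ≈⟨ +-comm (f P₁) (f P₂) ⟩
      f P₂ + f P₁  <⟨ +-mono-<-≤ (f P₂) (g P₂) (f P₁) (g P₁) f₂<g₂ (f≤g P₁) ⟩
      g P₂ + g P₁  ≈⟨ +-comm (g P₂) (g P₁) ⟩
      g P₁ + g P₂  ≈⟨ G.total ⟩
      Q            ∎)

  -- T and T′ are related by ≈ even when they are the same real: comparing them by
  -- conversion would make Agda unfold their Cauchy proofs.
  equilibrium⇒isEquilibriumTime : ∀ {Q f T T′} → 0ℝ < Q →
    IsEquilibrium N Q f T → T ≈ T′ → IsEquilibriumTime N Q T′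
  equilibrium⇒isEquilibriumTime {f = f} {T} {T′} 0<Q F T≈T′ =
    (f , record
      { isFlow       = isFlow
      ; nonVanishing = λ P f≉0 → ≈-trans (pathTime N f P) T T′ (nonVanishing P f≉0) T≈T′
      ; vanishing    = λ P f≈0 → ≤-trans T′ T (pathTime N f P)
                         (≈⇒≤ T′ T (≈-sym T T′ T≈T′)) (vanishing P f≈0)
      })
    , λ g S G → ≈-trans S T T′
        (≤-antisym S T (equilibriumTime-≤ 0<Q F G) (equilibriumTime-≤ 0<Q G F)) T≈T′
    where open IsEquilibrium F

  -- Existence of equilibria

  module _ (Q : ℝ) (0<Q : 0ℝ < Q) where
    open ≤-Reasoning

    -- The hypothesis says that `P₂`, carrying everything, is still no slower than the empty `P₁`,
    -- whose time is `α₁₂`.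
    onlyP₂ : Q ≤ (- α) / β₄₅ ⟨ 0<β₄₅ ⟩ → IsEquilibrium N Q (splitFlow 0ℝ Q) (α₄₅ + Q * β₄₅)
    onlyP₂ Q≤ = record
      { isFlow = record
        { nonNegative = λ { P₁ → <-irrefl 0ℝ ; P₂ → <⇒≤ 0ℝ Q 0<Q }
        ; total = ≡⇒≈ λ n → ℚ.+-identityˡ (seq Q n)
        }
      ; nonVanishing = λ { P₁ f₁≉0 → ⊥-elim (f₁≉0 (≈-refl 0ℝ)) ; P₂ _ → t₂≈T }
      ; vanishing = λ { P₁ _ → T≤t₁
                      ; P₂ _ → ≈⇒≤ T (t P₂) (≈-sym (t P₂) T t₂≈T) }
      }
      where
      T = α₄₅ + Q * β₄₅
      t = pathTime N (splitFlow 0ℝ Q)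

      t₂≈T : t P₂ ≈ T
      t₂≈T = begin-equality
        t P₂           ≈⟨ pathTime-affine (splitFlow 0ℝ Q) P₂ ⟩
        α₄₅ + β₄₅ * Q  ≈⟨ +-congˡ α₄₅ (β₄₅ * Q) (Q * β₄₅)
                            (≡⇒≈ λ n → ℚ.*-comm (seq β₄₅ n) (seq Q n)) ⟩
        T              ∎

      T≤t₁ : T ≤ t P₁
      -- Otherwise `α₁₂ < α₄₅ + β₄₅ * Q`. Since `α₁₂` is `α₄₅ + (- α)`, cancelling `α₄₅` gives
      -- `- α < β₄₅ * Q`, against the hypothesis.
      T≤t₁ t₁<T = Q≤ (/-<⇐<-* (- α) β₄₅ Q 0<β₄₅ (+-cancelˡ-< α₄₅ (- α) (β₄₅ * Q) (begin-strict
        α₄₅ + (- α)     ≈⟨ ≡⇒≈ (λ n → solve 3 (λ o₁ o₂ s → o₂ :+ (:- (o₂ :- o₁)) := o₁ :+ s :* con 0ℚ)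
                             refl (seq α₁₂ n) (seq α₄₅ n) (seq β₁₂ n)) ⟩
        α₁₂ + β₁₂ * 0ℝ  ≈⟨ pathTime-affine (splitFlow 0ℝ Q) P₁ ⟨
        t P₁            <⟨ t₁<T ⟩
        T               ≈⟨ t₂≈T ⟨
        t P₂            ≈⟨ pathTime-affine (splitFlow 0ℝ Q) P₂ ⟩
        α₄₅ + β₄₅ * Q   ∎)))

    onlyP₁ : Q ≤ α / β₁₂ ⟨ 0<β₁₂ ⟩ → IsEquilibrium N Q (splitFlow Q 0ℝ) (α₁₂ + Q * β₁₂)
    onlyP₁ Q≤ = record
      { isFlow = record
        { nonNegative = λ { P₁ → <⇒≤ 0ℝ Q 0<Q ; P₂ → <-irrefl 0ℝ }
        ; total = +-identityʳ Q
        }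
      ; nonVanishing = λ { P₁ _ → t₁≈T ; P₂ f₂≉0 → ⊥-elim (f₂≉0 (≈-refl 0ℝ)) }
      ; vanishing = λ { P₁ _ → ≈⇒≤ T (t P₁) (≈-sym (t P₁) T t₁≈T)
                      ; P₂ _ → T≤t₂ }
      }
      where
      T = α₁₂ + Q * β₁₂
      t = pathTime N (splitFlow Q 0ℝ)

      t₁≈T : t P₁ ≈ T
      t₁≈T = begin-equality
        t P₁           ≈⟨ pathTime-affine (splitFlow Q 0ℝ) P₁ ⟩
        α₁₂ + β₁₂ * Q  ≈⟨ +-congˡ α₁₂ (β₁₂ * Q) (Q * β₁₂)
                            (≡⇒≈ λ n → ℚ.*-comm (seq β₁₂ n) (seq Q n)) ⟩
        T              ∎

      T≤t₂ : T ≤ t P₂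
      T≤t₂ t₂<T = Q≤ (/-<⇐<-* α β₁₂ Q 0<β₁₂ (+-cancelˡ-< α₁₂ α (β₁₂ * Q) (begin-strict
        α₁₂ + α         ≈⟨ ≡⇒≈ (λ n → solve 3 (λ o₁ o₂ s → o₁ :+ (o₂ :- o₁) := o₂ :+ s :* con 0ℚ)
                             refl (seq α₁₂ n) (seq α₄₅ n) (seq β₄₅ n)) ⟩
        α₄₅ + β₄₅ * 0ℝ  ≈⟨ pathTime-affine (splitFlow Q 0ℝ) P₂ ⟨
        t P₂            <⟨ t₂<T ⟩
        T               ≈⟨ t₁≈T ⟨
        t P₁            ≈⟨ pathTime-affine (splitFlow Q 0ℝ) P₁ ⟩
        α₁₂ + β₁₂ * Q   ∎)))

    -- The equation for `p` comes from equating `α₁₂ + β₁₂ * p` with `α₄₅ + β₄₅ * (Q - p)`. Keeping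
    -- `p` abstract leaves its quotient form out of the computation.
    bothPaths : (α / β₁₂ ⟨ 0<β₁₂ ⟩) ⊔ ((- α) / β₄₅ ⟨ 0<β₄₅ ⟩) < Q →
      ∀ p → β * p ≈ α + Q * β₄₅ →
      IsEquilibrium N Q (splitFlow p (Q - p)) (α₁₂ + β₁₂ * p)
    bothPaths max<Q p βp≈ = record
      { isFlow = record
        { nonNegative = λ { P₁ → 0≤p ; P₂ → 0≤Q-p }
        ; total = x+[y-x]≈y p Q
        }
      ; nonVanishing = λ P _ → t≈T P
      ; vanishing = λ P _ → ≈⇒≤ (α₁₂ + β₁₂ * p) (pathTime N f P)
                              (≈-sym (pathTime N f P) (α₁₂ + β₁₂ * p) (t≈T P))
      }
      where
      f = splitFlow p (Q - p)

      α/β₁₂<Q : α / β₁₂ ⟨ 0<β₁₂ ⟩ < Q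
      α/β₁₂<Q = begin-strict
        α / β₁₂ ⟨ 0<β₁₂ ⟩
          ≤⟨ x≤x⊔y (α / β₁₂ ⟨ 0<β₁₂ ⟩) ((- α) / β₄₅ ⟨ 0<β₄₅ ⟩) ⟩
        (α / β₁₂ ⟨ 0<β₁₂ ⟩) ⊔ ((- α) / β₄₅ ⟨ 0<β₄₅ ⟩)
          <⟨ max<Q ⟩
        Q ∎

      -α/β₄₅<Q : (- α) / β₄₅ ⟨ 0<β₄₅ ⟩ < Q
      -α/β₄₅<Q = begin-strict
        (- α) / β₄₅ ⟨ 0<β₄₅ ⟩
          ≤⟨ y≤x⊔y (α / β₁₂ ⟨ 0<β₁₂ ⟩) ((- α) / β₄₅ ⟨ 0<β₄₅ ⟩) ⟩
        (α / β₁₂ ⟨ 0<β₁₂ ⟩) ⊔ ((- α) / β₄₅ ⟨ 0<β₄₅ ⟩)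
          <⟨ max<Q ⟩
        Q ∎

      0≤p : 0ℝ ≤ p
      -- A negative `p` makes `α + Q * β₄₅` negative, that is, `Q < - α / β₄₅`.
      0≤p p<0 = <-asym ((- α) / β₄₅ ⟨ 0<β₄₅ ⟩) Q -α/β₄₅<Q
        (<-/⇐*-< (- α) β₄₅ Q 0<β₄₅ (+-cancelˡ-< α (β₄₅ * Q) (- α) (begin-strict
          α + β₄₅ * Q  ≈⟨ +-congˡ α (β₄₅ * Q) (Q * β₄₅)
                            (≡⇒≈ λ n → ℚ.*-comm (seq β₄₅ n) (seq Q n)) ⟩
          α + Q * β₄₅  ≈⟨ βp≈ ⟨
          β * p        <⟨ *-monoʳ-< β p 0ℝ 0<β p<0 ⟩
          β * 0ℝ       ≈⟨ ≡⇒≈ (λ n → solve 2 (λ s o → s :* con 0ℚ := o :+ (:- o)) refl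
                            (seq β n) (seq α n)) ⟩
          α + (- α)    ∎)))

      0≤Q-p : 0ℝ ≤ Q - p
      -- Here `β * (Q - p)` equals `β₁₂ * Q - α`, so a negative `Q - p` would give `Q < α / β₁₂`.
      0≤Q-p Q-p<0 = <-asym (α / β₁₂ ⟨ 0<β₁₂ ⟩) Q α/β₁₂<Q
        (<-/⇐*-< α β₁₂ Q 0<β₁₂ (+-cancelˡ-< (Q * β₄₅) (β₁₂ * Q) α (begin-strict
          Q * β₄₅ + β₁₂ * Q       ≈⟨ ≡⇒≈ (λ n → solve 6 (λ s₁ s₂ s₄ s₅ q p →
                                       q :* (s₄ :+ s₅) :+ (s₁ :+ s₂) :* q
                                       := (s₁ :+ s₂ :+ s₄ :+ s₅) :* p
                                          :+ (s₁ :+ s₂ :+ s₄ :+ s₅) :* (q :- p))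
                                       refl (seq β₁ n) (seq β₂ n) (seq β₄ n) (seq β₅ n)
                                       (seq Q n) (seq p n)) ⟩
          β * p + β * (Q - p)     <⟨ +-monoʳ-< (β * p) (β * (Q - p)) (β * 0ℝ)
                                       (*-monoʳ-< β (Q - p) 0ℝ 0<β Q-p<0) ⟩
          β * p + β * 0ℝ          ≈⟨ ≡⇒≈ (λ n → solve 2 (λ s p → s :* p :+ s :* con 0ℚ := s :* p)
                                       refl (seq β n) (seq p n)) ⟩
          β * p                   ≈⟨ βp≈ ⟩
          α + Q * β₄₅             ≈⟨ +-comm α (Q * β₄₅) ⟩
          Q * β₄₅ + α             ∎)))

      t≈T : ∀ P → pathTime N f P ≈ α₁₂ + β₁₂ * p
      t≈T P₁ = pathTime-affine f P₁
      -- The time is rearranged to expose `α + Q * β₄₅`, which is traded for `β * p`; then `β - β₄₅`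
      -- leaves the slope `β₁₂`.
      t≈T P₂ = begin-equality
        pathTime N f P₂              ≈⟨ pathTime-affine f P₂ ⟩
        α₄₅ + β₄₅ * (Q - p)          ≈⟨ ≡⇒≈ (λ n → solve 5 (λ o₁ o₂ s q p →
                                          o₂ :+ s :* (q :- p)
                                          := (o₁ :- s :* p) :+ ((o₂ :- o₁) :+ q :* s))
                                          refl (seq α₁₂ n) (seq α₄₅ n) (seq β₄₅ n)
                                          (seq Q n) (seq p n)) ⟩
        α₁₂ - β₄₅ * p + (α + Q * β₄₅)  ≈⟨ +-congˡ (α₁₂ - β₄₅ * p) (β * p) (α + Q * β₄₅) βp≈ ⟨
        α₁₂ - β₄₅ * p + β * p        ≈⟨ ≡⇒≈ (λ n → solve 6 (λ o s₁ s₂ s₄ s₅ p →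
                                          (o :- (s₄ :+ s₅) :* p) :+ (s₁ :+ s₂ :+ s₄ :+ s₅) :* p
                                          := o :+ (s₁ :+ s₂) :* p)
                                          refl (seq α₁₂ n) (seq β₁ n) (seq β₂ n) (seq β₄ n)
                                          (seq β₅ n) (seq p n)) ⟩
        α₁₂ + β₁₂ * p                ∎

lemma1 : (N : Parameters) (Q : ℝ) → 0ℝ < Q →
    let open Parameters N in
    (Q ≤ (- α) / β₄₅ ⟨ 0<β₄₅ ⟩ → IsEquilibriumTime N Q (α₄₅ + Q * β₄₅))
    × (Q ≤ α / β₁₂ ⟨ 0<β₁₂ ⟩ → IsEquilibriumTime N Q (α₁₂ + Q * β₁₂))
    × ((α / β₁₂ ⟨ 0<β₁₂ ⟩) ⊔ ((- α) / β₄₅ ⟨ 0<β₄₅ ⟩) < Q →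
    IsEquilibriumTime N Q (α₁₂ + (α + Q * β₄₅) * β₁₂ / β ⟨ 0<β ⟩))
lemma1 N Q 0<Q =
    (λ Q≤ → equilibrium⇒isEquilibriumTime N 0<Q (onlyP₂ N Q 0<Q Q≤)
              (≈-refl (α₄₅ + Q * β₄₅)))
  , (λ Q≤ → equilibrium⇒isEquilibriumTime N 0<Q (onlyP₁ N Q 0<Q Q≤)
              (≈-refl (α₁₂ + Q * β₁₂)))
  -- The flow on `P₁` is `κ / β`. The equilibrium time appears with `β₁₂` outside the quotient, and
  -- `*-/-assoc` moves it into the numerator.
  , (λ max<Q → equilibrium⇒isEquilibriumTime N 0<Q
       (bothPaths N Q 0<Q max<Q (κ / β ⟨ 0<β ⟩) (*-/-cancel κ β 0<β))
       (+-congˡ α₁₂ (β₁₂ * (κ / β ⟨ 0<β ⟩)) (κ * β₁₂ / β ⟨ 0<β ⟩) (*-/-assoc β₁₂ κ β 0<β)))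
  where
  open Parameters N
  κ = α + Q * β₄₅
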